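{- Let $r>s\ge1$ be integers and let $n\ge1$ be an integer. Then the $(r,s)$-Bell number $\phi_n^{(r,s)}$ satisfies \[ \phi_n^{(r,s)}=\frac{(r-s)^{sn}}{e}\sum_{k=0}^{\infty}\frac{1}{k!}\prod_{l=1}^{s}\frac{\Gamma\!\big(n+\frac{k-l+1}{r-s}\big)}{\Gamma\!\big(\frac{k-l+1}{r-s}\big)}. \]
   Context: Let $D=\frac{d}{dx}$ and let $x$ denote the operator of multiplication by $x$. For integers $r\ge s\ge1$ and $n\ge1$, the generalized $(r,s)$-Stirling numbers of the second kind $S_{r,s}(n,k)$ (of Blasiak–Penson–Solomon) are defined by the normal ordering identity \[ (x^{r}D^{s})^{n}=x^{n(r-s)}\sum_{k=s}^{ns}S_{r,s}(n,k)\,x^{k}D^{k}, \] and the $(r,s)$-Bell numbers are $\phi_n^{(r,s)}=\sum_{k=s}^{ns}S_{r,s}(n,k)$. Here the ratio $\Gamma(n+a)/\Gamma(a)$ stands for the rising factorial $a(a+1)\cdots(a+n-1)$ (which is its value, or limiting value, also when $a$ is a nonpositive integer). -}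

module Defs where

open import Algebra.Bundles using (CommutativeRing)
import Algebra.Properties.AbelianGroup as AbelianGroupProperties
import Algebra.Properties.Ring as RingProperties
import Algebra.Properties.CommutativeSemigroup as CommutativeSemigroupProperties
open import Data.Nat.Base as ℕ using (ℕ; zero; suc; _∸_; _!; z≤n; s≤s)
import Data.Nat.Properties as ℕₚ
open import Data.Integer.Base as ℤ using (+_; +[1+_]; -[1+_])
import Data.Integer.Properties as ℤₚ
import Data.Rational.Base as ℚ
import Data.Rational.Properties as ℚₚ
open import Data.Rational.Unnormalised.Base as ℚᵘ using (mkℚᵘ)
import Data.Rational.Unnormalised.Properties as ℚᵘₚ
open import Data.Integer.Solver renaming (module +-*-Solver to ℤ-Solver)
open import Data.Product.Base using (∃-syntax; _×_; _,_)
open import Data.Sum.Base using (inj₁; inj₂)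
open import Function.Base using (_∘_)
open import Relation.Binary.PropositionalEquality
  using (_≡_; _≗_; refl; sym; trans; cong; cong₂; subst)

-- Kept generic because type checking unfolds the arithmetic of ℚ on variables.
module Identities {c ℓ} (R : CommutativeRing c ℓ) where
  open CommutativeRing R renaming (Carrier to A; trans to _∙_; sym to inv)
  open AbelianGroupProperties +-abelianGroup public
    using (⁻¹-anti-homo‿-; ⁻¹-∙-comm; xyx⁻¹≈y; //-rightDividesˡ; //-rightDividesʳ)
  open CommutativeSemigroupProperties *-commutativeSemigroup
    using (xy∙z≈x∙zy; xy∙z≈y∙zx)
  open CommutativeSemigroupProperties
    (CommutativeRing.+-commutativeSemigroup R) using (interchange)
  open RingProperties ring using (x[y-z]≈xy-xz)

  swap : ∀ p q → p - q ≈ - (q - p)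
  swap p q = inv (⁻¹-anti-homo‿- q p)

  sub-add : ∀ a b c d → (a - b) + (c - d) ≈ (a + c) - (b + d)
  sub-add a b c d = interchange a (- b) c (- d) ∙ +-congˡ (⁻¹-∙-comm b d)

  telescope : ∀ a b c → (a - b) + (b - c) ≈ a - c
  telescope a b c = inv (+-assoc (a - b) b (- c)) ∙ +-congʳ (//-rightDividesˡ b a)

  mul-sub : ∀ a b c d → a * (b - d) + d * (a - c) ≈ a * b - c * d
  mul-sub a b c d =
    +-cong (x[y-z]≈xy-xz a b d)
      (x[y-z]≈xy-xz d a c ∙ +-cong (*-comm d a) (-‿cong (*-comm d c)))
    ∙ telescope (a * b) (a * d) (c * d)

  inv-sub : ∀ u v p q → u * v * (q - p) ≈ u * (q * v) - v * (p * u)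
  inv-sub u v p q = x[y-z]≈xy-xz (u * v) q p
    ∙ +-cong (xy∙z≈x∙zy u v q) (-‿cong (xy∙z≈y∙zx u v p))

  factor : ∀ a u p → a * u - p * u ≈ u * (a - p)
  factor a u p = inv (x[y-z]≈xy-xz u a p
    ∙ +-cong (*-comm u a) (-‿cong (*-comm u p)))

open ℚ using (ℚ; mkℚ; 0ℚ; 1ℚ; ½; _+_; _*_; _-_; -_; ∣_∣; _≤_; _<_)

sum< : ℕ → (ℕ → ℚ) → ℚ
sum< zero    f = 0ℚ
sum< (suc n) f = sum< n f + f n

prod< : ℕ → (ℕ → ℚ) → ℚ
prod< zero    f = 1ℚ
prod< (suc n) f = prod< n f * f n

-- f a + … + f b and f a * … * f b, empty when b < a.
sumFromTo : ℕ → ℕ → (ℕ → ℚ) → ℚ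
sumFromTo a b f = sum< (suc b ∸ a) (λ i → f (a ℕ.+ i))

prodFromTo : ℕ → ℕ → (ℕ → ℚ) → ℚ
prodFromTo a b f = prod< (suc b ∸ a) (λ i → f (a ℕ.+ i))

infix 5 sumFromTo prodFromTo
syntax sumFromTo  a b (λ k → t) = Σ[ k ∈ a ⋯ b ] t
syntax prodFromTo a b (λ k → t) = Π[ k ∈ a ⋯ b ] t

-- A series is its sequence of coefficients: f stands for Σₖ f k xᵏ.
Series : Set
Series = ℕ → ℚ

Op : Set
Op = Series → Series

X : Op
X f zero    = 0ℚ
X f (suc k) = f k

D : Op
D f k = (+ suc k ℚ./ 1) * f (suc k)

infixr 8 _^∘_
_^∘_ : Op → ℕ → Op
(T ^∘ zero)  f = f
(T ^∘ suc n) f = T ((T ^∘ n) f)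

-- S is the family of coefficients in the normal ordering
--   (xʳ Dˢ)ⁿ = xⁿ⁽ʳ⁻ˢ⁾ Σₖ S(n,k) xᵏ Dᵏ.
-- Linear independence of the operators xᵏ Dᵏ makes S n k unique for
-- s ≤ k ≤ n s; the other values of S are unconstrained and never used.
IsStirling : (r s : ℕ) → (ℕ → ℕ → ℚ) → Set
IsStirling r s S =
  ∀ n → 1 ℕ.≤ n → ∀ (f : Series) →
    (((X ^∘ r) ∘ (D ^∘ s)) ^∘ n) f
      ≗ (X ^∘ (n ℕ.* (r ∸ s)))
          (λ j → Σ[ k ∈ s ⋯ n ℕ.* s ] (S n k * (X ^∘ k) ((D ^∘ k) f) j))

bell : (s : ℕ) → (ℕ → ℕ → ℚ) → ℕ → ℚ
bell s S n = Σ[ k ∈ s ⋯ n ℕ.* s ] S n k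

-- a (a + 1) ⋯ (a + n - 1), the meaning of Γ(n + a) / Γ(a)
rising : ℚ → ℕ → ℚ
rising a n = prod< n (λ i → a + (+ i ℚ./ 1))

invFact : ℕ → ℚ
invFact k = ℚ._/_ (+ 1) (k !) {{k ℕₚ.!≢0}}

-- (k - l + 1) / (r - s)
arg : (r s : ℕ) → s ℕ.< r → (k l : ℕ) → ℚ
arg r s s<r k l =
  ℚ._/_ ((+ k) ℤ.- (+ l) ℤ.+ (+ 1)) (r ∸ s) {{ℕ.>-nonZero (ℕₚ.m<n⇒0<n∸m s<r)}}

IsCauchy : (ℕ → ℚ) → Set
IsCauchy x = ∀ ε → 0ℚ < ε →
  ∃[ N ] (∀ m n → N ℕ.≤ m → N ℕ.≤ n → ∣ x m - x n ∣ < ε)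

-- Real numbers are Cauchy sequences of rationals, compared by _≃ᴿ_.
record ℝ : Set where
  constructor mkℝ
  field
    seq    : ℕ → ℚ
    cauchy : IsCauchy seq
open ℝ public

infix 4 _≃ᴿ_ _≤ᴿ_

_≃ᴿ_ : ℝ → ℝ → Set
x ≃ᴿ y = ∀ ε → 0ℚ < ε → ∃[ N ] (∀ n → N ℕ.≤ n → ∣ seq x n - seq y n ∣ < ε)

-- The ε makes this the non-strict order of the limits.
_≤ᴿ_ : ℝ → ℝ → Set
x ≤ᴿ y = ∀ ε → 0ℚ < ε → ∃[ N ] (∀ n → N ℕ.≤ n → seq x n < seq y n + ε)

module Z = ℤ-Solver

module I = Identities ℚₚ.+-*-commutativeRing

half>0 : ∀ {ε} → 0ℚ < ε → 0ℚ < ½ * ε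
half>0 {ε} 0<ε = ℚₚ.positive⁻¹ (½ * ε) {{ℚₚ.pos*pos⇒pos ½ ε {{ℚ.positive 0<ε}}}}

half+half : ∀ ε → ½ * ε + ½ * ε ≡ ε
half+half ε = trans (sym (ℚₚ.*-distribʳ-+ ε ½ ½)) (ℚₚ.*-identityˡ ε)

shrink : ∀ B {ε} → 0ℚ < B → 0ℚ < ε → ∃[ δ ] (0ℚ < δ × B * δ ≡ ε)
shrink B {ε} 0<B 0<ε = (ℚ.1/ B) * ε , ℚₚ.positive⁻¹ _ , eq
  where
  instance
    B+ : ℚ.Positive B
    B+ = ℚ.positive 0<B
    B≢0 : ℚ.NonZero B
    B≢0 = ℚₚ.pos⇒nonZero B
    ε+ : ℚ.Positive ε
    ε+ = ℚ.positive 0<ε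
    1/B+ : ℚ.Positive (ℚ.1/ B)
    1/B+ = ℚₚ.1/pos⇒pos B
    δ+ : ℚ.Positive ((ℚ.1/ B) * ε)
    δ+ = ℚₚ.pos*pos⇒pos (ℚ.1/ B) ε
  eq : B * ((ℚ.1/ B) * ε) ≡ ε
  eq = trans (sym (ℚₚ.*-assoc B (ℚ.1/ B) ε))
      (trans (cong (_* ε) (ℚₚ.*-inverseʳ B)) (ℚₚ.*-identityˡ ε))

*-mono-≤ : ∀ {a b c d} → 0ℚ ≤ a → 0ℚ ≤ d → a ≤ b → c ≤ d → a * c ≤ b * d
*-mono-≤ {a} {b} {c} {d} 0≤a 0≤d a≤b c≤d = ℚₚ.≤-trans
  (ℚₚ.*-monoˡ-≤-nonNeg a {{ℚ.nonNegative 0≤a}} c≤d)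
  (ℚₚ.*-monoʳ-≤-nonNeg d {{ℚ.nonNegative 0≤d}} a≤b)

∣-∣-comm : ∀ p q → ∣ p - q ∣ ≡ ∣ q - p ∣
∣-∣-comm p q = trans (cong ∣_∣
  (I.swap p q))
  (ℚₚ.∣-p∣≡∣p∣ (q - p))

∣p∣≤∣p-q∣+∣q∣ : ∀ p q → ∣ p ∣ ≤ ∣ p - q ∣ + ∣ q ∣
∣p∣≤∣p-q∣+∣q∣ p q = subst (λ t → ∣ t ∣ ≤ ∣ p - q ∣ + ∣ q ∣)
  (I.//-rightDividesˡ q p)
  (ℚₚ.∣p+q∣≤∣p∣+∣q∣ (p - q) q)

∣p∣-∣q∣≤∣p-q∣ : ∀ p q → ∣ p ∣ - ∣ q ∣ ≤ ∣ p - q ∣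
∣p∣-∣q∣≤∣p-q∣ p q = subst (∣ p ∣ - ∣ q ∣ ≤_)
  (I.//-rightDividesʳ ∣ q ∣ ∣ p - q ∣)
  (ℚₚ.+-monoˡ-≤ (- ∣ q ∣) (∣p∣≤∣p-q∣+∣q∣ p q))

∣a∣≤ : ∀ {a d} → a ≤ d → - a ≤ d → ∣ a ∣ ≤ d
∣a∣≤ {a} {d} a≤d -a≤d with ℚₚ.∣p∣≡p∨∣p∣≡-p a
... | inj₁ eq = subst (_≤ d) (sym eq) a≤d
... | inj₂ eq = subst (_≤ d) (sym eq) -a≤d

∣∣p∣-∣q∣∣≤∣p-q∣ : ∀ p q → ∣ ∣ p ∣ - ∣ q ∣ ∣ ≤ ∣ p - q ∣
∣∣p∣-∣q∣∣≤∣p-q∣ p q = ∣a∣≤ (∣p∣-∣q∣≤∣p-q∣ p q)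
  (subst (_≤ ∣ p - q ∣)
    (I.swap ∣ q ∣ ∣ p ∣)
    (subst (∣ q ∣ - ∣ p ∣ ≤_) (∣-∣-comm q p) (∣p∣-∣q∣≤∣p-q∣ q p)))

p-p : ∀ p → ∣ p - p ∣ ≡ 0ℚ
p-p p = cong ∣_∣ (ℚₚ.+-inverseʳ p)

≤-max₁ : ∀ {M N m} → M ℕ.⊔ N ℕ.≤ m → M ℕ.≤ m
≤-max₁ {M} {N} = ℕₚ.≤-trans (ℕₚ.m≤m⊔n M N)

≤-max₂ : ∀ {M N m} → M ℕ.⊔ N ℕ.≤ m → N ℕ.≤ m
≤-max₂ {M} {N} = ℕₚ.≤-trans (ℕₚ.m≤n⊔m M N)

bounded : ∀ x → IsCauchy x →
  ∃[ B ] ∃[ N ] (0ℚ < B × (∀ n → N ℕ.≤ n → ∣ x n ∣ ≤ B))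
bounded x cx with cx 1ℚ (ℚₚ.positive⁻¹ 1ℚ)
... | N , h = 1ℚ + ∣ x N ∣ , N , 0<B , bd
  where
  0<B : 0ℚ < 1ℚ + ∣ x N ∣
  0<B = ℚₚ.+-mono-<-≤ (ℚₚ.positive⁻¹ 1ℚ) (ℚₚ.0≤∣p∣ (x N))
  bd : ∀ n → N ℕ.≤ n → ∣ x n ∣ ≤ 1ℚ + ∣ x N ∣
  bd n N≤n = ℚₚ.≤-trans (∣p∣≤∣p-q∣+∣q∣ (x n) (x N))
    (ℚₚ.+-monoˡ-≤ ∣ x N ∣ (ℚₚ.<⇒≤ (h n N N≤n ℕₚ.≤-refl)))

constCauchy : ∀ q → IsCauchy (λ _ → q)
constCauchy q ε 0<ε = 0 , λ _ _ _ _ → subst (_< ε) (sym (p-p q)) 0<ε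

addCauchy : ∀ x y → IsCauchy x → IsCauchy y → IsCauchy (λ n → x n + y n)
addCauchy x y cx cy ε 0<ε
  with cx (½ * ε) (half>0 0<ε) | cy (½ * ε) (half>0 0<ε)
... | M , hx | N , hy = M ℕ.⊔ N , λ m n m≥ n≥ →
  subst (∣ (x m + y m) - (x n + y n) ∣ <_) (half+half ε)
    (ℚₚ.≤-<-trans
      (subst (λ t → ∣ t ∣ ≤ ∣ x m - x n ∣ + ∣ y m - y n ∣)
        (I.sub-add (x m) (x n) (y m) (y n))
        (ℚₚ.∣p+q∣≤∣p∣+∣q∣ (x m - x n) (y m - y n)))
      (ℚₚ.+-mono-< (hx m n (≤-max₁ m≥) (≤-max₁ n≥))
                   (hy m n (≤-max₂ {M} m≥) (≤-max₂ {M} n≥))))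

negCauchy : ∀ x → IsCauchy x → IsCauchy (λ n → - x n)
negCauchy x cx ε 0<ε with cx ε 0<ε
... | N , h = N , λ m n m≥ n≥ → subst (_< ε)
  (trans (sym (ℚₚ.∣-p∣≡∣p∣ (x m - x n))) (cong ∣_∣
    (ℚₚ.neg-distrib-+ (x m) (- x n))))
  (h m n m≥ n≥)

absCauchy : ∀ x → IsCauchy x → IsCauchy (λ n → ∣ x n ∣)
absCauchy x cx ε 0<ε with cx ε 0<ε
... | N , h = N , λ m n m≥ n≥ →
  ℚₚ.≤-<-trans (∣∣p∣-∣q∣∣≤∣p-q∣ (x m) (x n)) (h m n m≥ n≥)

mul-close : ∀ a b c d B C δ η {ε} → 0ℚ < B → 0ℚ < C → B * δ ≡ ½ * ε → C * η ≡ ½ * ε →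
  ∣ a ∣ ≤ B → ∣ d ∣ ≤ C → ∣ a - c ∣ < η → ∣ b - d ∣ < δ → ∣ a * b - c * d ∣ < ε
mul-close a b c d B C δ η {ε} 0<B 0<C Bδ Cη a≤B d≤C a-c b-d = ℚₚ.≤-<-trans tri
    (subst (∣ a ∣ * ∣ b - d ∣ + ∣ d ∣ * ∣ a - c ∣ <_) (half+half ε)
      (ℚₚ.+-mono-<
        (subst (∣ a ∣ * ∣ b - d ∣ <_) Bδ (scaled a B (b - d) δ 0<B a≤B b-d))
        (subst (∣ d ∣ * ∣ a - c ∣ <_) Cη (scaled d C (a - c) η 0<C d≤C a-c))))
  where
  tri : ∣ a * b - c * d ∣ ≤ ∣ a ∣ * ∣ b - d ∣ + ∣ d ∣ * ∣ a - c ∣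
  tri = subst (_≤ ∣ a ∣ * ∣ b - d ∣ + ∣ d ∣ * ∣ a - c ∣)
    (cong ∣_∣ (I.mul-sub a b c d))
    (subst (∣ a * (b - d) + d * (a - c) ∣ ≤_)
      (cong₂ _+_ (ℚₚ.∣p*q∣≡∣p∣*∣q∣ a (b - d)) (ℚₚ.∣p*q∣≡∣p∣*∣q∣ d (a - c)))
      (ℚₚ.∣p+q∣≤∣p∣+∣q∣ (a * (b - d)) (d * (a - c))))
  scaled : ∀ p B q δ → 0ℚ < B → ∣ p ∣ ≤ B → ∣ q ∣ < δ → ∣ p ∣ * ∣ q ∣ < B * δ
  scaled p B q δ 0<B p≤ q< = ℚₚ.≤-<-trans
    (ℚₚ.*-monoʳ-≤-nonNeg ∣ q ∣ {{ℚₚ.∣-∣-nonNeg q}} p≤)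
    (ℚₚ.*-monoʳ-<-pos B {{ℚ.positive 0<B}} q<)

mulCauchy : ∀ x y → IsCauchy x → IsCauchy y → IsCauchy (λ n → x n * y n)
mulCauchy x y cx cy ε 0<ε =
  let B , K , 0<B , bx = bounded x cx
      C , L , 0<C , by = bounded y cy
      δ , 0<δ , Bδ     = shrink B 0<B (half>0 0<ε)
      η , 0<η , Cη     = shrink C 0<C (half>0 0<ε)
      M , hx           = cx η 0<η
      N , hy           = cy δ 0<δ
  in (K ℕ.⊔ L) ℕ.⊔ (M ℕ.⊔ N) , λ m n m≥ n≥ →
    mul-close (x m) (y m) (x n) (y n) B C δ η 0<B 0<C Bδ Cη
      (bx m (≤-max₁ (≤-max₁ {K ℕ.⊔ L} m≥)))
      (by n (≤-max₂ {K} (≤-max₁ {K ℕ.⊔ L} n≥)))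
      (hx m n (≤-max₁ (≤-max₂ {K ℕ.⊔ L} m≥)) (≤-max₁ (≤-max₂ {K ℕ.⊔ L} n≥)))
      (hy m n (≤-max₂ {M} (≤-max₂ {K ℕ.⊔ L} m≥)) (≤-max₂ {M} (≤-max₂ {K ℕ.⊔ L} n≥)))

fromℚ : ℚ → ℝ
fromℚ q = mkℝ (λ _ → q) (constCauchy q)

fromℕ : ℕ → ℝ
fromℕ n = fromℚ (+ n ℚ./ 1)

0ᴿ : ℝ
0ᴿ = fromℚ 0ℚ

infixl 6 _+ᴿ_ _-ᴿ_
infixl 7 _*ᴿ_

_+ᴿ_ : ℝ → ℝ → ℝ
x +ᴿ y = mkℝ (λ n → seq x n + seq y n) (addCauchy (seq x) (seq y) (cauchy x) (cauchy y))

-ᴿ_ : ℝ → ℝ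
-ᴿ x = mkℝ (λ n → - seq x n) (negCauchy (seq x) (cauchy x))

_-ᴿ_ : ℝ → ℝ → ℝ
x -ᴿ y = x +ᴿ (-ᴿ y)

_*ᴿ_ : ℝ → ℝ → ℝ
x *ᴿ y = mkℝ (λ n → seq x n * seq y n) (mulCauchy (seq x) (seq y) (cauchy x) (cauchy y))

∣_∣ᴿ : ℝ → ℝ
∣ x ∣ᴿ = mkℝ (λ n → ∣ seq x n ∣) (absCauchy (seq x) (cauchy x))

-- Apartness from zero: |x| is eventually bounded below by some δ > 0.
Apart0 : ℝ → Set
Apart0 x = ∃[ δ ] ∃[ N ] (0ℚ < δ × (∀ n → N ℕ.≤ n → δ ≤ ∣ seq x n ∣))

∣p∣>0⇒nonZero : ∀ p {δ} → 0ℚ < δ → δ ≤ ∣ p ∣ → ℚ.NonZero p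
∣p∣>0⇒nonZero p 0<δ δ≤ = ℚ.≢-nonZero {p} λ { refl →
  ℚₚ.<-irrefl refl (ℚₚ.<-≤-trans 0<δ δ≤) }

-- The first N terms, which may vanish, are dropped.
invSeq : (x : ℝ) → Apart0 x → ℕ → ℚ
invSeq x (δ , N , 0<δ , h) n =
  ℚ.1/_ (seq x (N ℕ.+ n)) {{∣p∣>0⇒nonZero (seq x (N ℕ.+ n)) 0<δ (h (N ℕ.+ n) (ℕₚ.m≤m+n N n))}}

inv-bound : ∀ p δ C .{{_ : ℚ.NonZero p}} → 0ℚ ≤ C → δ ≤ ∣ p ∣ → C * δ ≡ 1ℚ →
  ∣ ℚ.1/ p ∣ ≤ C
inv-bound p δ C 0≤C δ≤ Cδ = subst (_≤ C) (ℚₚ.*-identityˡ ∣ ℚ.1/ p ∣)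
  (subst (λ t → t * ∣ ℚ.1/ p ∣ ≤ C) Cδ
    (subst (C * δ * ∣ ℚ.1/ p ∣ ≤_) last
      (ℚₚ.*-monoʳ-≤-nonNeg ∣ ℚ.1/ p ∣ {{ℚₚ.∣-∣-nonNeg (ℚ.1/ p)}}
        (ℚₚ.*-monoˡ-≤-nonNeg C {{ℚ.nonNegative 0≤C}} δ≤))))
  where
  last : C * ∣ p ∣ * ∣ ℚ.1/ p ∣ ≡ C
  last = trans (ℚₚ.*-assoc C ∣ p ∣ ∣ ℚ.1/ p ∣)
    (trans (cong (C *_) (trans (sym (ℚₚ.∣p*q∣≡∣p∣*∣q∣ p (ℚ.1/ p)))
      (cong ∣_∣ (ℚₚ.*-inverseʳ p)))) (ℚₚ.*-identityʳ C))

inv-diff : ∀ p q .{{_ : ℚ.NonZero p}} .{{_ : ℚ.NonZero q}} →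
  ℚ.1/ p - ℚ.1/ q ≡ (ℚ.1/ p) * (ℚ.1/ q) * (q - p)
inv-diff p q = sym (trans
  (I.inv-sub (ℚ.1/ p) (ℚ.1/ q) p q)
  (trans (cong₂ (λ a b → (ℚ.1/ p) * a - (ℚ.1/ q) * b)
      (ℚₚ.*-inverseʳ q) (ℚₚ.*-inverseʳ p))
    (cong₂ _-_ (ℚₚ.*-identityʳ (ℚ.1/ p)) (ℚₚ.*-identityʳ (ℚ.1/ q)))))

inv-Lipschitz : ∀ p q δ C .{{_ : ℚ.NonZero p}} .{{_ : ℚ.NonZero q}} →
  0ℚ ≤ C → C * δ ≡ 1ℚ → δ ≤ ∣ p ∣ → δ ≤ ∣ q ∣ → ∣ ℚ.1/ p - ℚ.1/ q ∣ ≤ C * C * ∣ q - p ∣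
inv-Lipschitz p q δ C 0≤C Cδ p≥ q≥ = subst (_≤ C * C * ∣ q - p ∣) (sym eq)
    (ℚₚ.*-monoʳ-≤-nonNeg ∣ q - p ∣ {{ℚₚ.∣-∣-nonNeg (q - p)}}
      (*-mono-≤ (ℚₚ.0≤∣p∣ (ℚ.1/ p)) 0≤C
        (inv-bound p δ C 0≤C p≥ Cδ) (inv-bound q δ C 0≤C q≥ Cδ)))
  where
  eq : ∣ ℚ.1/ p - ℚ.1/ q ∣ ≡ ∣ ℚ.1/ p ∣ * ∣ ℚ.1/ q ∣ * ∣ q - p ∣
  eq = trans (cong ∣_∣ (inv-diff p q))
    (trans (ℚₚ.∣p*q∣≡∣p∣*∣q∣ ((ℚ.1/ p) * (ℚ.1/ q)) (q - p))
      (cong (_* ∣ q - p ∣) (ℚₚ.∣p*q∣≡∣p∣*∣q∣ (ℚ.1/ p) (ℚ.1/ q))))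

invCauchy : (x : ℝ) (x#0 : Apart0 x) → IsCauchy (invSeq x x#0)
invCauchy x (δ , N , 0<δ , h) ε 0<ε =
  let C , 0<C , δC   = shrink δ 0<δ (ℚₚ.positive⁻¹ 1ℚ)
      CC+            = ℚₚ.pos*pos⇒pos C {{ℚ.positive 0<C}} C {{ℚ.positive 0<C}}
      η , 0<η , CCη  = shrink (C * C) (ℚₚ.positive⁻¹ (C * C) {{CC+}}) 0<ε
      M , hx         = cauchy x η 0<η
      N≤ = λ n → ℕₚ.m≤m+n N n
      M≤ = λ n n≥ → ℕₚ.≤-trans n≥ (ℕₚ.m≤n+m n N)
  in M , λ m n m≥ n≥ →
    ℚₚ.≤-<-trans
      (inv-Lipschitz (seq x (N ℕ.+ m)) (seq x (N ℕ.+ n)) δ C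
        {{∣p∣>0⇒nonZero (seq x (N ℕ.+ m)) 0<δ (h (N ℕ.+ m) (N≤ m))}}
        {{∣p∣>0⇒nonZero (seq x (N ℕ.+ n)) 0<δ (h (N ℕ.+ n) (N≤ n))}}
        (ℚₚ.<⇒≤ 0<C) (trans (ℚₚ.*-comm C δ) δC)
        (h (N ℕ.+ m) (N≤ m)) (h (N ℕ.+ n) (N≤ n)))
      (subst (C * C * ∣ seq x (N ℕ.+ n) - seq x (N ℕ.+ m) ∣ <_) CCη
        (ℚₚ.*-monoʳ-<-pos (C * C) {{CC+}}
          (hx (N ℕ.+ n) (N ℕ.+ m) (M≤ n n≥) (M≤ m m≥))))

inverse : (x : ℝ) → Apart0 x → ℝ
inverse x x#0 = mkℝ (invSeq x x#0) (invCauchy x x#0)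

divide : (x y : ℝ) → Apart0 y → ℝ
divide x y y#0 = x *ᴿ inverse y y#0

infixl 7 divide
syntax divide x y y#0 = x /ᴿ y [ y#0 ]

inv-close : ∀ a p C ε η .{{_ : ℚ.NonZero p}} → 0ℚ < C → C * η ≡ ε →
  ∣ ℚ.1/ p ∣ ≤ C → ∣ a - p ∣ < η → ∣ a * (ℚ.1/ p) - 1ℚ ∣ < ε
inv-close a p C ε η 0<C Cη bC lt = subst (_< ε) (sym eq) (ℚₚ.≤-<-trans
    (ℚₚ.*-monoʳ-≤-nonNeg ∣ a - p ∣ {{ℚₚ.∣-∣-nonNeg (a - p)}} bC)
    (subst (C * ∣ a - p ∣ <_) Cη (ℚₚ.*-monoʳ-<-pos C {{ℚ.positive 0<C}} lt)))
  where
  eq : ∣ a * (ℚ.1/ p) - 1ℚ ∣ ≡ ∣ ℚ.1/ p ∣ * ∣ a - p ∣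
  eq = trans (cong ∣_∣ (trans
      (cong (λ t → a * (ℚ.1/ p) - t) (sym (ℚₚ.*-inverseʳ p)))
      (I.factor a (ℚ.1/ p) p)))
    (ℚₚ.∣p*q∣≡∣p∣*∣q∣ (ℚ.1/ p) (a - p))

inverseʳ : (x : ℝ) (x#0 : Apart0 x) → x *ᴿ inverse x x#0 ≃ᴿ fromℚ 1ℚ
inverseʳ x (δ , N , 0<δ , h) ε 0<ε =
  let x#0 = δ , N , 0<δ , h
      C , K , 0<C , bC = bounded (invSeq x x#0) (invCauchy x x#0)
      η , 0<η , Cη     = shrink C 0<C 0<ε
      M , hx           = cauchy x η 0<η
  in K ℕ.⊔ M , λ n n≥ →
    inv-close (seq x n) (seq x (N ℕ.+ n)) C ε η
      {{∣p∣>0⇒nonZero (seq x (N ℕ.+ n)) 0<δ (h (N ℕ.+ n) (ℕₚ.m≤m+n N n))}}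
      0<C Cη (bC n (≤-max₁ n≥))
      (hx n (N ℕ.+ n) (≤-max₂ {K} n≥) (ℕₚ.≤-trans (≤-max₂ {K} n≥) (ℕₚ.m≤n+m n N)))

infix 4 _⟶_
_⟶_ : (ℕ → ℝ) → ℝ → Set
u ⟶ x = ∀ ε → 0ℚ < ε →
  ∃[ N ] (∀ n → N ℕ.≤ n → ∣ u n -ᴿ x ∣ᴿ ≤ᴿ fromℚ ε)

partialSum : (ℕ → ℝ) → ℕ → ℝ
partialSum a zero    = 0ᴿ
partialSum a (suc n) = partialSum a n +ᴿ a n

HasSum : (ℕ → ℝ) → ℝ → Set
HasSum a x = partialSum a ⟶ x

-- The representing sequence of e: Σ 1/k! over 0 ≤ k ≤ n.
eSeq : ℕ → ℚ
eSeq n = sum< (suc n) invFact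

unit : ℕ → ℚ
unit n = + 1 ℚ./ suc n

toℚᵘ-unit : ∀ n → ℚ.toℚᵘ (unit n) ℚᵘ.≃ mkℚᵘ (+ 1) n
toℚᵘ-unit n = ℚₚ.toℚᵘ-fromℚᵘ (mkℚᵘ (+ 1) n)

unit-antitone : ∀ {m n} → m ℕ.≤ n → unit n ≤ unit m
unit-antitone {m} {n} m≤n = ℚₚ.toℚᵘ-cancel-≤
  (ℚᵘₚ.≤-respˡ-≃ (ℚᵘₚ.≃-sym (toℚᵘ-unit n))
    (ℚᵘₚ.≤-respʳ-≃ (ℚᵘₚ.≃-sym (toℚᵘ-unit m))
      (ℚᵘ.*≤* (ℤₚ.*-monoˡ-≤-nonNeg (+ 1) (ℤ.+≤+ (s≤s m≤n))))))

1/-antitone : ∀ {m n} .{{_ : ℕ.NonZero m}} .{{_ : ℕ.NonZero n}} →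
  m ℕ.≤ n → + 1 ℚ./ n ≤ + 1 ℚ./ m
1/-antitone {suc m} {suc n} (s≤s m≤n) = unit-antitone m≤n

unit>0 : ∀ n → 0ℚ < unit n
unit>0 n = ℚₚ.toℚᵘ-cancel-<
  (ℚᵘₚ.<-respʳ-≃ (ℚᵘₚ.≃-sym (toℚᵘ-unit n)) (ℚᵘ.*<* (ℤ.+<+ (s≤s z≤n))))

1/>0 : ∀ n .{{_ : ℕ.NonZero n}} → 0ℚ < + 1 ℚ./ n
1/>0 (suc n) = unit>0 n

invFact>0 : ∀ k → 0ℚ < invFact k
invFact>0 k = 1/>0 (k !) {{k ℕₚ.!≢0}}

archimedean : ∀ ε → 0ℚ < ε → ∃[ N ] (unit N < ε)
archimedean (mkℚ (+ 0) d c) 0<ε with () ← ℚ.positive 0<ε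
archimedean (mkℚ -[1+ p ] d c) 0<ε with () ← ℚ.positive 0<ε
archimedean (mkℚ +[1+ p ] d c) 0<ε = suc d , ℚₚ.toℚᵘ-cancel-<
  (ℚᵘₚ.<-respˡ-≃ (ℚᵘₚ.≃-sym (toℚᵘ-unit (suc d)))
    (ℚᵘ.*<* (ℤ.+<+ (s≤s (ℕₚ.≤-trans
      (ℕₚ.≤-reflexive (cong suc (ℕₚ.+-identityʳ d)))
      (ℕₚ.m≤m+n (suc d) (p ℕ.* suc (suc d))))))))

-- 1/((n+1)(n+2)) + 1/(n+2) = 1/(n+1)
unit-step : ∀ n → + 1 ℚ./ (suc n ℕ.* suc (suc n)) + unit (suc n) ≡ unit n
unit-step n = ℚₚ.toℚᵘ-injective (ℚᵘₚ.≃-trans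
  (ℚₚ.toℚᵘ-homo-+ (unit d) (unit (suc n)))
  (ℚᵘₚ.≃-trans (ℚᵘₚ.+-cong (toℚᵘ-unit d) (toℚᵘ-unit (suc n)))
    (ℚᵘₚ.≃-trans (ℚᵘ.*≡* eq) (ℚᵘₚ.≃-sym (toℚᵘ-unit n)))))
  where
  d = suc n ℕ.+ n ℕ.* suc (suc n)
  eq : (+ 1 ℤ.* + suc (suc n) ℤ.+ + 1 ℤ.* + suc d) ℤ.* + suc n
         ≡ + 1 ℤ.* + (suc d ℕ.* suc (suc n))
  eq rewrite ℤₚ.pos-* (suc d) (suc (suc n)) | ℤₚ.pos-* (suc n) (suc (suc n)) =
    Z.solve 1 (λ a → (Z.con (+ 1) Z.:* (Z.con (+ 1) Z.:+ a)
                        Z.:+ Z.con (+ 1) Z.:* (a Z.:* (Z.con (+ 1) Z.:+ a))) Z.:* a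
                 Z.:= Z.con (+ 1) Z.:* ((a Z.:* (Z.con (+ 1) Z.:+ a)) Z.:* (Z.con (+ 1) Z.:+ a)))
      refl (+ suc n)

invFact-step : ∀ n → invFact (suc (suc n)) + unit (suc n) ≤ unit n
invFact-step n = subst (invFact (suc (suc n)) + unit (suc n) ≤_) (unit-step n)
  (ℚₚ.+-monoˡ-≤ (unit (suc n))
    (1/-antitone {n = suc (suc n) !} {{_}} {{suc (suc n) ℕₚ.!≢0}}
      (ℕₚ.≤-trans (ℕₚ.≤-reflexive (ℕₚ.*-comm (suc n) (suc (suc n))))
        (ℕₚ.*-monoʳ-≤ (suc (suc n)) (ℕₚ.m≤m*n (suc n) (n !) {{n ℕₚ.!≢0}})))))

eSeq-suc : ∀ n → eSeq n ≤ eSeq (suc n)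
eSeq-suc n = subst (_≤ eSeq (suc n)) (ℚₚ.+-identityʳ (eSeq n))
  (ℚₚ.+-monoʳ-≤ (eSeq n) (ℚₚ.<⇒≤ (invFact>0 (suc n))))

eSeq-mono : ∀ m k → eSeq m ≤ eSeq (k ℕ.+ m)
eSeq-mono m zero    = ℚₚ.≤-refl
eSeq-mono m (suc k) = ℚₚ.≤-trans (eSeq-mono m k) (eSeq-suc (k ℕ.+ m))

-- eSeq (n + 1) + 1/(n + 1) decreases in n.
upper : ℕ → ℚ
upper n = eSeq (suc n) + unit n

upper-suc : ∀ n → upper (suc n) ≤ upper n
upper-suc n = subst (_≤ upper n)
  (sym (ℚₚ.+-assoc (eSeq (suc n)) (invFact (suc (suc n))) (unit (suc n))))
  (ℚₚ.+-monoʳ-≤ (eSeq (suc n)) (invFact-step n))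

upper-anti : ∀ m k → upper (k ℕ.+ m) ≤ upper m
upper-anti m zero    = ℚₚ.≤-refl
upper-anti m (suc k) = ℚₚ.≤-trans (upper-suc (k ℕ.+ m)) (upper-anti m k)

eSeq-tail : ∀ N n → suc N ℕ.≤ n → eSeq n ≤ eSeq (suc N) + unit N
eSeq-tail N (suc n) (s≤s N≤n) = ℚₚ.≤-trans
  (subst (_≤ upper n) (ℚₚ.+-identityʳ (eSeq (suc n)))
    (ℚₚ.+-monoʳ-≤ (eSeq (suc n)) (ℚₚ.<⇒≤ (unit>0 n))))
  (subst (λ t → upper t ≤ upper N) (ℕₚ.m∸n+n≡m N≤n) (upper-anti N (n ∸ N)))

eSeq-≤ : ∀ {m n} → m ℕ.≤ n → eSeq m ≤ eSeq n
eSeq-≤ {m} {n} m≤n =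
  subst (λ t → eSeq m ≤ eSeq t) (ℕₚ.m∸n+n≡m m≤n) (eSeq-mono m (n ∸ m))

eSeq-close : ∀ N m n → suc N ℕ.≤ m → suc N ℕ.≤ n → eSeq m - eSeq n ≤ unit N
eSeq-close N m n m≥ n≥ = subst (eSeq m - eSeq n ≤_)
  (I.xyx⁻¹≈y (eSeq (suc N)) (unit N))
  (ℚₚ.+-mono-≤ (eSeq-tail N m m≥) (ℚₚ.neg-antimono-≤ (eSeq-≤ n≥)))

eCauchy : IsCauchy eSeq
eCauchy ε 0<ε =
  let N , lt = archimedean ε 0<ε
  in suc N , λ m n m≥ n≥ → ℚₚ.≤-<-trans
    (∣a∣≤ (eSeq-close N m n m≥ n≥)
      (subst (_≤ unit N) (I.swap (eSeq n) (eSeq m)) (eSeq-close N n m n≥ m≥)))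
    lt

e : ℝ
e = mkℝ eSeq eCauchy

e#0 : Apart0 e
e#0 = 1ℚ , 0 , ℚₚ.positive⁻¹ 1ℚ , λ n _ → ℚₚ.≤-trans (1≤ n) (p≤∣p∣ (eSeq n))
  where
  1≤ : ∀ n → 1ℚ ≤ eSeq n
  1≤ n = eSeq-≤ {0} {n} z≤n
  p≤∣p∣ : ∀ p → p ≤ ∣ p ∣
  p≤∣p∣ p with ℚₚ.≤-total 0ℚ p
  ... | inj₁ 0≤p = ℚₚ.≤-reflexive (sym (ℚₚ.0≤p⇒∣p∣≡p 0≤p))
  ... | inj₂ p≤0 = ℚₚ.≤-trans p≤0 (ℚₚ.0≤∣p∣ p)

-- Comparing coefficients of x^(n(r-s)+j) in the normal ordering identity applied
-- to eˣ = Σ xᵏ/k! gives, since D eˣ = eˣ,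
--   (1/j!) Π_{i<n} Π_{l≤s} (j + i(r-s) - l + 1) = Σₖ S(n,k) · [xʲ] xᵏ eˣ.
-- Each xᵏ eˣ has coefficient sum e, so summing over j gives bell · e on the
-- right, and the left-hand side is (r-s)^(sn) times the summand of the theorem.
module Submission where

open import Defs
open import Data.Nat.Base using (ℕ; _≤_; _<_; _∸_; _^_) renaming (_*_ to _·_)
open import Data.Rational.Base using (ℚ; _*_)
open import Data.Product.Base using (∃-syntax; _×_)
open import Data.Nat.Base using (zero; suc; _⊔_; _!; NonZero; >-nonZero; z≤n; s≤s)
  renaming (_+_ to _∔_)
import Data.Nat.Properties as ℕₚ
open import Data.Integer.Base as ℤ using (+_)
import Data.Integer.Properties as ℤₚ
open import Data.Integer.Solver renaming (module +-*-Solver to ℤ-Solver)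
open import Data.Rational.Base as ℚ using (0ℚ; 1ℚ; ½; _+_; _-_; -_; ∣_∣; _/_; fromℚᵘ)
import Data.Rational.Properties as ℚₚ
open import Data.Rational.Unnormalised.Base as ℚᵘ using (mkℚᵘ)
import Data.Rational.Unnormalised.Properties as ℚᵘₚ
open import Algebra.Bundles using (CommutativeRing)
import Algebra.Properties.CommutativeSemigroup as CommutativeSemigroupProperties
import Algebra.Properties.Ring as RingProperties
open import Data.Product.Base using (_,_)
open import Function.Base using (_∘_)
open import Relation.Binary.PropositionalEquality
  using (_≡_; _≗_; refl; sym; trans; cong; cong₂; subst; module ≡-Reasoning)

module *-CS = CommutativeSemigroupProperties
  (CommutativeRing.*-commutativeSemigroup ℚₚ.+-*-commutativeRing)
module +-CS = CommutativeSemigroupProperties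
  (CommutativeRing.+-commutativeSemigroup ℚₚ.+-*-commutativeRing)
module ℚ-Ring = RingProperties (CommutativeRing.ring ℚₚ.+-*-commutativeRing)

-- Arithmetic of fractions and of the embedded integers.

-- `i / suc d` computes to `fromℚᵘ (mkℚᵘ i d)`, so the homomorphism laws of `fromℚᵘ` reduce
-- identities between fractions to cross-multiplied identities in the integers.
fromℚᵘ-homo-+ : ∀ p q → fromℚᵘ (p ℚᵘ.+ q) ≡ fromℚᵘ p + fromℚᵘ q
fromℚᵘ-homo-+ p q = ℚₚ.toℚᵘ-injective (ℚᵘₚ.≃-trans (ℚₚ.toℚᵘ-fromℚᵘ (p ℚᵘ.+ q))
  (ℚᵘₚ.≃-sym (ℚᵘₚ.≃-trans (ℚₚ.toℚᵘ-homo-+ (fromℚᵘ p) (fromℚᵘ q))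
    (ℚᵘₚ.+-cong (ℚₚ.toℚᵘ-fromℚᵘ p) (ℚₚ.toℚᵘ-fromℚᵘ q)))))

fromℚᵘ-homo-* : ∀ p q → fromℚᵘ (p ℚᵘ.* q) ≡ fromℚᵘ p * fromℚᵘ q
fromℚᵘ-homo-* p q = ℚₚ.toℚᵘ-injective (ℚᵘₚ.≃-trans (ℚₚ.toℚᵘ-fromℚᵘ (p ℚᵘ.* q))
  (ℚᵘₚ.≃-sym (ℚᵘₚ.≃-trans (ℚₚ.toℚᵘ-homo-* (fromℚᵘ p) (fromℚᵘ q))
    (ℚᵘₚ.*-cong (ℚₚ.toℚᵘ-fromℚᵘ p) (ℚₚ.toℚᵘ-fromℚᵘ q)))))

fromℚᵘ-homo‿- : ∀ p → fromℚᵘ (ℚᵘ.- p) ≡ - fromℚᵘ p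
fromℚᵘ-homo‿- p = ℚₚ.toℚᵘ-injective (ℚᵘₚ.≃-trans (ℚₚ.toℚᵘ-fromℚᵘ (ℚᵘ.- p))
  (ℚᵘₚ.≃-sym (ℚᵘₚ.≃-trans (ℚₚ.toℚᵘ-homo‿- (fromℚᵘ p))
    (ℚᵘₚ.-‿cong (ℚₚ.toℚᵘ-fromℚᵘ p)))))

/1-homo-+ : ∀ i j → (i ℤ.+ j) / 1 ≡ i / 1 + j / 1
/1-homo-+ i j = trans
  (ℚₚ.fromℚᵘ-cong {mkℚᵘ (i ℤ.+ j) 0} {mkℚᵘ i 0 ℚᵘ.+ mkℚᵘ j 0} (ℚᵘ.*≡*
    (ℤ-Solver.solve 2 (λ i j → (i :+ j) :* one := (i :* one :+ j :* one) :* one) refl i j)))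
  (fromℚᵘ-homo-+ (mkℚᵘ i 0) (mkℚᵘ j 0))
  where
  open ℤ-Solver using (_:+_; _:*_; _:=_; con)
  one : ∀ {n} → ℤ-Solver.Polynomial n
  one = con (+ 1)

/1-homo-sub : ∀ i j → (i ℤ.- j) / 1 ≡ i / 1 - j / 1
/1-homo-sub i j = trans (/1-homo-+ i (ℤ.- j))
  (cong (λ t → i / 1 + t) (fromℚᵘ-homo‿- (mkℚᵘ j 0)))

*-/-cancel : ∀ d .{{_ : NonZero d}} z → + d / 1 * (z / d) ≡ z / 1
*-/-cancel (suc d) z = trans (sym (fromℚᵘ-homo-* (mkℚᵘ (+ suc d) 0) (mkℚᵘ z d)))
  (ℚₚ.fromℚᵘ-cong {mkℚᵘ (+ suc d) 0 ℚᵘ.* mkℚᵘ z d} {mkℚᵘ z 0} (ℚᵘ.*≡* (trans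
    (ℤₚ.*-identityʳ (+ suc d ℤ.* z))
    (trans (ℤₚ.*-comm (+ suc d) z)
      (cong (λ t → z ℤ.* + t) (sym (ℕₚ.*-identityˡ (suc d))))))))

/1-homo-* : ∀ i j → (i ℤ.* j) / 1 ≡ i / 1 * (j / 1)
/1-homo-* i j = fromℚᵘ-homo-* (mkℚᵘ i 0) (mkℚᵘ j 0)

ι : ℕ → ℚ
ι n = + n / 1

ι-homo-+ : ∀ m n → ι (m ∔ n) ≡ ι m + ι n
ι-homo-+ m n = /1-homo-+ (+ m) (+ n)

ι-homo-* : ∀ m n → ι (m · n) ≡ ι m * ι n
ι-homo-* m n = trans (cong (_/ 1) (ℤₚ.pos-* m n)) (/1-homo-* (+ m) (+ n))

-- Finite sums and products.

sum<-cong : ∀ n {f g : ℕ → ℚ} → f ≗ g → sum< n f ≡ sum< n g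
sum<-cong zero    f≗g = refl
sum<-cong (suc n) f≗g = cong₂ _+_ (sum<-cong n f≗g) (f≗g n)

prod<-cong : ∀ n {f g : ℕ → ℚ} → f ≗ g → prod< n f ≡ prod< n g
prod<-cong zero    f≗g = refl
prod<-cong (suc n) f≗g = cong₂ _*_ (prod<-cong n f≗g) (f≗g n)

sum<-+ : ∀ n (f g : ℕ → ℚ) → sum< n (λ i → f i + g i) ≡ sum< n f + sum< n g
sum<-+ zero    f g = sym (ℚₚ.+-identityˡ 0ℚ)
sum<-+ (suc n) f g = trans (cong (_+ (f n + g n)) (sum<-+ n f g))
  (+-CS.interchange (sum< n f) (sum< n g) (f n) (g n))

sum<-*ˡ : ∀ n c (f : ℕ → ℚ) → sum< n (λ i → c * f i) ≡ c * sum< n f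
sum<-*ˡ zero    c f = sym (ℚₚ.*-zeroʳ c)
sum<-*ˡ (suc n) c f = trans (cong (_+ c * f n) (sum<-*ˡ n c f))
  (sym (ℚₚ.*-distribˡ-+ c (sum< n f) (f n)))

sum<-zero : ∀ n → sum< n (λ _ → 0ℚ) ≡ 0ℚ
sum<-zero zero    = refl
sum<-zero (suc n) = trans (ℚₚ.+-identityʳ _) (sum<-zero n)

-- Multiplication by x puts a zero coefficient in front, which costs one extra term.
sum<-X : ∀ n f → sum< (suc n) (X f) ≡ sum< n f
sum<-X zero    f = ℚₚ.+-identityʳ 0ℚ
sum<-X (suc n) f = cong (_+ f n) (sum<-X n f)

prod<-* : ∀ n (f g : ℕ → ℚ) → prod< n (λ i → f i * g i) ≡ prod< n f * prod< n g
prod<-* zero    f g = sym (ℚₚ.*-identityˡ 1ℚ)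
prod<-* (suc n) f g = trans (cong (_* (f n * g n)) (prod<-* n f g))
  (*-CS.interchange (prod< n f) (prod< n g) (f n) (g n))

prod<-one : ∀ n → prod< n (λ _ → 1ℚ) ≡ 1ℚ
prod<-one zero    = refl
prod<-one (suc n) = trans (ℚₚ.*-identityʳ _) (prod<-one n)

prod<-swap : ∀ m n (f : ℕ → ℕ → ℚ) →
  prod< m (λ i → prod< n (f i)) ≡ prod< n (λ j → prod< m (λ i → f i j))
prod<-swap zero    n f = sym (prod<-one n)
prod<-swap (suc m) n f = trans (cong (_* prod< n (f m)) (prod<-swap m n f))
  (sym (prod<-* n (λ j → prod< m (λ i → f i j)) (f m)))

prod<-ι^ : ∀ n d (f : ℕ → ℚ) → ι (d ^ n) * prod< n f ≡ prod< n (λ i → ι d * f i)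
prod<-ι^ zero    d f = ℚₚ.*-identityˡ 1ℚ
prod<-ι^ (suc n) d f = begin
  ι (d · d ^ n) * (prod< n f * f n)       ≡⟨ cong (_* (prod< n f * f n)) (ι-homo-* d (d ^ n)) ⟩
  ι d * ι (d ^ n) * (prod< n f * f n)     ≡⟨ cong (_* (prod< n f * f n)) (ℚₚ.*-comm (ι d) (ι (d ^ n))) ⟩
  ι (d ^ n) * ι d * (prod< n f * f n)     ≡⟨ *-CS.interchange (ι (d ^ n)) (ι d) (prod< n f) (f n) ⟩
  ι (d ^ n) * prod< n f * (ι d * f n)     ≡⟨ cong (_* (ι d * f n)) (prod<-ι^ n d f) ⟩
  prod< n (λ i → ι d * f i) * (ι d * f n) ∎
  where open ≡-Reasoning

-- `prod<` recurses on its last factor, whereas the recursion for falling factorials splits off the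
-- first.
prod<-head : ∀ n (f : ℕ → ℚ) → prod< (suc n) f ≡ f 0 * prod< n (f ∘ suc)
prod<-head zero    f = trans (ℚₚ.*-identityˡ (f 0)) (sym (ℚₚ.*-identityʳ (f 0)))
prod<-head (suc n) f = trans (cong (_* f (suc n)) (prod<-head n f))
  (ℚₚ.*-assoc (f 0) (prod< n (f ∘ suc)) (f (suc n)))

-- Falling factorials and the action of the operators on coefficients.

-- At `x = ι j` this is the eigenvalue of xˢDˢ on the monomial xʲ. For j < s a factor is zero, as it
-- must be, so no case split on j ≥ s arises.
falling : ℚ → ℕ → ℚ
falling x s = prod< s (λ l → x - ι l)

falling-0 : ∀ s → falling (ι 0) (suc s) ≡ 0ℚ
falling-0 s = trans (prod<-head s (λ l → ι 0 - ι l))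
  (ℚₚ.*-zeroˡ (prod< s (λ l → ι 0 - ι (suc l))))

-- The factor at `l = 0` is j + 1, and in the others both terms drop by one. The factor split off is
-- the one produced by differentiating x^(j+1).
falling-suc : ∀ j s → falling (ι (suc j)) (suc s) ≡ falling (ι j) s * ι (suc j)
falling-suc j s = begin
  falling (ι (suc j)) (suc s)
    ≡⟨ prod<-head s (λ l → ι (suc j) - ι l) ⟩
  (ι (suc j) - ι 0) * prod< s (λ l → ι (suc j) - ι (suc l))
    ≡⟨ cong₂ _*_ (ℚₚ.+-identityʳ (ι (suc j))) (prod<-cong s step) ⟩
  ι (suc j) * falling (ι j) s
    ≡⟨ ℚₚ.*-comm (ι (suc j)) (falling (ι j) s) ⟩
  falling (ι j) s * ι (suc j) ∎
  where
  open ≡-Reasoning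
  step : ∀ l → ι (suc j) - ι (suc l) ≡ ι j - ι l
  step l = begin
    ι (suc j) - ι (suc l)           ≡⟨ cong₂ _-_ (ι-homo-+ 1 j) (ι-homo-+ 1 l) ⟩
    (ι 1 + ι j) - (ι 1 + ι l)       ≡⟨ I.sub-add (ι 1) (ι 1) (ι j) (ι l) ⟨
    (ι 1 - ι 1) + (ι j - ι l)       ≡⟨ cong (_+ (ι j - ι l)) (ℚₚ.+-inverseʳ (ι 1)) ⟩
    0ℚ + (ι j - ι l)                ≡⟨ ℚₚ.+-identityˡ (ι j - ι l) ⟩
    ι j - ι l ∎

X-cong : ∀ k {f g : Series} → f ≗ g → (X ^∘ k) f ≗ (X ^∘ k) g
X-cong zero    f≗g j       = f≗g j
X-cong (suc k) f≗g zero    = refl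
X-cong (suc k) f≗g (suc j) = X-cong k f≗g j

^∘-+ : ∀ (T : Op) m n f → (T ^∘ (m ∔ n)) f ≡ (T ^∘ m) ((T ^∘ n) f)
^∘-+ T zero    n f = refl
^∘-+ T (suc m) n f = cong T (^∘-+ T m n f)

^∘-comm : ∀ (T : Op) n f → T ((T ^∘ n) f) ≡ (T ^∘ n) (T f)
^∘-comm T zero    f = refl
^∘-comm T (suc n) f = cong T (^∘-comm T n f)

X-coeff : ∀ k f j → (X ^∘ k) f (k ∔ j) ≡ f j
X-coeff zero    f j = refl
X-coeff (suc k) f j = X-coeff k f j

-- Induction on s for all series at once: the outermost `X` lowers the index, and one `D` is moved
-- inside so that the hypothesis applies to `D f`. At index 0 the left side has been shifted out and
-- the right side has a zero factor.
XD-coeff : ∀ s f j → (X ^∘ s) ((D ^∘ s) f) j ≡ falling (ι j) s * f j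
XD-coeff zero    f j       = sym (ℚₚ.*-identityˡ (f j))
XD-coeff (suc s) f zero    = sym (trans (cong (_* f 0) (falling-0 s)) (ℚₚ.*-zeroˡ (f 0)))
XD-coeff (suc s) f (suc j) = begin
  (X ^∘ s) (D ((D ^∘ s) f)) j               ≡⟨ cong (λ g → (X ^∘ s) g j) (^∘-comm D s f) ⟩
  (X ^∘ s) ((D ^∘ s) (D f)) j               ≡⟨ XD-coeff s (D f) j ⟩
  falling (ι j) s * (ι (suc j) * f (suc j)) ≡⟨ ℚₚ.*-assoc (falling (ι j) s) (ι (suc j)) (f (suc j)) ⟨
  falling (ι j) s * ι (suc j) * f (suc j)   ≡⟨ cong (_* f (suc j)) (falling-suc j s) ⟨
  falling (ι (suc j)) (suc s) * f (suc j)   ∎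
  where open ≡-Reasoning

-- Writing r as d + s splits xʳDˢ into a shift by d after the diagonal operator xˢDˢ.
XrDs-coeff : ∀ {r} s d → d ∔ s ≡ r → ∀ f j →
  (X ^∘ r) ((D ^∘ s) f) (d ∔ j) ≡ falling (ι j) s * f j
XrDs-coeff s d refl f j = begin
  (X ^∘ (d ∔ s)) ((D ^∘ s) f) (d ∔ j)        ≡⟨ cong (λ g → g (d ∔ j)) (^∘-+ X d s ((D ^∘ s) f)) ⟩
  (X ^∘ d) ((X ^∘ s) ((D ^∘ s) f)) (d ∔ j)   ≡⟨ X-coeff d ((X ^∘ s) ((D ^∘ s) f)) j ⟩
  (X ^∘ s) ((D ^∘ s) f) j                    ≡⟨ XD-coeff s f j ⟩
  falling (ι j) s * f j                      ∎
  where open ≡-Reasoning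

-- Every application raises the exponent by d, so the one numbered i, counted from 0, acts on
-- x^(id+j) and contributes the falling factorial of id + j.
XrDs^n-coeff : ∀ {r} s d → d ∔ s ≡ r → ∀ n f j →
  (((X ^∘ r) ∘ (D ^∘ s)) ^∘ n) f (n · d ∔ j)
    ≡ prod< n (λ i → falling (ι (i · d ∔ j)) s) * f j
XrDs^n-coeff s d eq zero    f j = sym (ℚₚ.*-identityˡ (f j))
XrDs^n-coeff {r} s d eq (suc n) f j = begin
  L (g n) (d ∔ n · d ∔ j)      ≡⟨ cong (L (g n)) (ℕₚ.+-assoc d (n · d) j) ⟩
  L (g n) (d ∔ (n · d ∔ j))    ≡⟨ XrDs-coeff s d eq (g n) (n · d ∔ j) ⟩
  F n * g n (n · d ∔ j)        ≡⟨ cong (F n *_) (XrDs^n-coeff s d eq n f j) ⟩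
  F n * (prod< n F * f j)      ≡⟨ *-CS.x∙yz≈yx∙z (F n) (prod< n F) (f j) ⟩
  prod< n F * F n * f j        ∎
  where
  open ≡-Reasoning
  L : Op
  L = (X ^∘ r) ∘ (D ^∘ s)
  g : ℕ → Series
  g m = (L ^∘ m) f
  F : ℕ → ℚ
  F i = falling (ι (i · d ∔ j)) s

-- The exponential series as a fixed point of differentiation.

D-cong : ∀ {f g : Series} → f ≗ g → D f ≗ D g
D-cong f≗g k = cong (ι (suc k) *_) (f≗g (suc k))

ι*1/ : ∀ n .{{_ : NonZero n}} → ι n * (+ 1 / n) ≡ 1ℚ
ι*1/ n = *-/-cancel n (+ 1)

1/-* : ∀ m n .{{_ : NonZero m}} .{{_ : NonZero n}} .{{_ : NonZero (m · n)}} →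
  ι m * (+ 1 / (m · n)) ≡ + 1 / n
1/-* m n = begin
  ι m * v                          ≡⟨ ℚₚ.*-identityʳ (ι m * v) ⟨
  -- The inserted 1 is n · (1/n); regrouping then lets mn cancel against 1/(mn).
  ι m * v * 1ℚ                     ≡⟨ cong (ι m * v *_) (ι*1/ n) ⟨
  ι m * v * (ι n * u)              ≡⟨ *-CS.interchange (ι m) v (ι n) u ⟩
  ι m * ι n * (v * u)              ≡⟨ cong (_* (v * u)) (ι-homo-* m n) ⟨
  ι (m · n) * (v * u)              ≡⟨ ℚₚ.*-assoc (ι (m · n)) v u ⟨
  ι (m · n) * v * u                ≡⟨ cong (_* u) (ι*1/ (m · n)) ⟩
  1ℚ * u                           ≡⟨ ℚₚ.*-identityˡ u ⟩
  u                                ∎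
  where
  open ≡-Reasoning
  u = + 1 / n
  v = + 1 / (m · n)

-- `invFact` is the series of eˣ. Since `suc k !` unfolds to `suc k · k !`, this is the cancellation
-- (k+1)/(k+1)! = 1/k!.
D-invFact : D invFact ≗ invFact
D-invFact k = 1/-* (suc k) (k !) {{_}} {{k ℕₚ.!≢0}} {{suc k ℕₚ.!≢0}}

D^-invFact : ∀ k → (D ^∘ k) invFact ≗ invFact
D^-invFact zero    j = refl
D^-invFact (suc k) j = trans (D-cong (D^-invFact k) j) (D-invFact j)

-- Series whose sum is a rational multiple of e.

-- Since eSeq represents e, this says Σⱼ a j = q e without passing through ℝ.
infix 4 _SumsTo_·e
record _SumsTo_·e (a : Series) (q : ℚ) : Set where
  field
    close : ∀ ε → 0ℚ ℚ.< ε →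
      ∃[ N ] (∀ m n → N ≤ m → N ≤ n → ∣ sum< m a - q * eSeq n ∣ ℚ.< ε)
open _SumsTo_·e

sumsTo-cong : ∀ {a b p} → a ≗ b → a SumsTo p ·e → b SumsTo p ·e
sumsTo-cong {p = p} a≗b ha .close ε 0<ε =
  let N , h = ha .close ε 0<ε
  in N , λ m n m≥ n≥ →
    subst (λ t → ∣ t - p * eSeq n ∣ ℚ.< ε) (sum<-cong m a≗b) (h m n m≥ n≥)

sumsTo-0 : (λ _ → 0ℚ) SumsTo 0ℚ ·e
sumsTo-0 .close ε 0<ε = 0 , λ m n _ _ → subst (ℚ._< ε)
  (sym (cong ∣_∣ (cong₂ _-_ (sum<-zero m) (ℚₚ.*-zeroˡ (eSeq n))))) 0<ε

sumsTo-+ : ∀ {a b p q} → a SumsTo p ·e → b SumsTo q ·e →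
  (λ j → a j + b j) SumsTo p + q ·e
sumsTo-+ {a} {b} {p} {q} ha hb .close ε 0<ε =
  let M , h = ha .close (½ * ε) (half>0 0<ε)
      N , k = hb .close (½ * ε) (half>0 0<ε)
  in M ⊔ N , λ m n m≥ n≥ →
    subst (∣ sum< m (λ j → a j + b j) - (p + q) * eSeq n ∣ ℚ.<_) (half+half ε)
      (ℚₚ.≤-<-trans
        (subst (λ t → ∣ t ∣ ℚ.≤ ∣ A m n ∣ + ∣ B m n ∣) (eq m n)
          (ℚₚ.∣p+q∣≤∣p∣+∣q∣ (A m n) (B m n)))
        (ℚₚ.+-mono-< (h m n (≤-max₁ m≥) (≤-max₁ n≥))
                     (k m n (≤-max₂ {M} m≥) (≤-max₂ {M} n≥))))
  where
  A B : ℕ → ℕ → ℚ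
  A m n = sum< m a - p * eSeq n
  B m n = sum< m b - q * eSeq n
  eq : ∀ m n → A m n + B m n ≡ sum< m (λ j → a j + b j) - (p + q) * eSeq n
  eq m n = trans (I.sub-add (sum< m a) (p * eSeq n) (sum< m b) (q * eSeq n))
    (sym (cong₂ _-_ (sum<-+ m a b) (ℚₚ.*-distribʳ-+ (eSeq n) p q)))

sumsTo-*ˡ : ∀ {a p} c → a SumsTo p ·e → (λ j → c * a j) SumsTo c * p ·e
sumsTo-*ˡ {a} {p} c ha .close ε 0<ε =
  let δ , 0<δ , Bδ = shrink B 0<B 0<ε
      N , h        = ha .close δ 0<δ
  in N , λ m n m≥ n≥ → subst (ℚ._< ε) (sym (eq m n))
    (ℚₚ.≤-<-trans
      (ℚₚ.*-monoʳ-≤-nonNeg ∣ A m n ∣ {{ℚₚ.∣-∣-nonNeg (A m n)}} ∣c∣≤B)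
      (subst (B * ∣ A m n ∣ ℚ.<_) Bδ
        (ℚₚ.*-monoʳ-<-pos B {{ℚ.positive 0<B}} (h m n m≥ n≥))))
  where
  B : ℚ
  -- The added 1 keeps the bound positive when c = 0, so that ε can be divided by it.
  B = 1ℚ + ∣ c ∣
  0<B : 0ℚ ℚ.< B
  0<B = ℚₚ.+-mono-<-≤ (ℚₚ.positive⁻¹ 1ℚ) (ℚₚ.0≤∣p∣ c)
  ∣c∣≤B : ∣ c ∣ ℚ.≤ B
  ∣c∣≤B = subst (ℚ._≤ B) (ℚₚ.+-identityˡ ∣ c ∣)
    (ℚₚ.+-monoˡ-≤ ∣ c ∣ (ℚₚ.nonNegative⁻¹ 1ℚ))
  A : ℕ → ℕ → ℚ
  A m n = sum< m a - p * eSeq n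
  eq : ∀ m n → ∣ sum< m (λ j → c * a j) - c * p * eSeq n ∣ ≡ ∣ c ∣ * ∣ A m n ∣
  eq m n = trans
    (cong ∣_∣ (trans (cong₂ _-_ (sum<-*ˡ m c a) (ℚₚ.*-assoc c p (eSeq n)))
      (sym (ℚ-Ring.x[y-z]≈xy-xz c (sum< m a) (p * eSeq n)))))
    (ℚₚ.∣p*q∣≡∣p∣*∣q∣ c (A m n))

sumsTo-sum< : ∀ l {a : ℕ → Series} {p : ℕ → ℚ} → (∀ i → a i SumsTo p i ·e) →
  (λ j → sum< l (λ i → a i j)) SumsTo sum< l p ·e
sumsTo-sum< zero    h = sumsTo-0
sumsTo-sum< (suc l) h = sumsTo-+ (sumsTo-sum< l h) (h l)

sumsTo-X : ∀ {a p} → a SumsTo p ·e → X a SumsTo p ·e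
sumsTo-X {a} {p} ha .close ε 0<ε =
  let N , h = ha .close ε 0<ε
  -- The threshold is one later because `X` inserts a leading zero; it also rules out m = 0.
  in suc N , λ { (suc m) n (s≤s m≥) n≥ →
    subst (λ t → ∣ t - p * eSeq n ∣ ℚ.< ε) (sym (sum<-X m a))
      (h m n m≥ (ℕₚ.<⇒≤ n≥)) }

sumsTo-X^ : ∀ k {a p} → a SumsTo p ·e → (X ^∘ k) a SumsTo p ·e
sumsTo-X^ zero    ha = ha
sumsTo-X^ (suc k) ha = sumsTo-X (sumsTo-X^ k ha)

-- `eSeq m` is by definition the sum of the first m + 1 terms, so the claim is the Cauchy property
-- of `eSeq` shifted by one.
sumsTo-invFact : invFact SumsTo 1ℚ ·e
sumsTo-invFact .close ε 0<ε =
  let N , h = eCauchy ε 0<ε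
  in suc N , λ { (suc m) n (s≤s m≥) n≥ →
    subst (λ t → ∣ eSeq m - t ∣ ℚ.< ε) (sym (ℚₚ.*-identityˡ (eSeq n)))
      (h m n m≥ (ℕₚ.<⇒≤ n≥)) }

-- Since Dᵏeˣ = eˣ and shifting preserves the sum, each xᵏDᵏeˣ has coefficient sum e; the weights
-- `S n k` therefore add up to the Bell number.
sumsTo-normalOrdered : ∀ s S n →
  (λ j → Σ[ k ∈ s ⋯ n · s ] (S n k * (X ^∘ k) ((D ^∘ k) invFact) j)) SumsTo bell s S n ·e
sumsTo-normalOrdered s S n = sumsTo-sum< (suc (n · s) ∸ s) λ i →
  let k = s ∔ i
  in subst (λ q → (λ j → S n k * (X ^∘ k) ((D ^∘ k) invFact) j) SumsTo q ·e)
       (ℚₚ.*-identityʳ (S n k))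
       (sumsTo-*ˡ (S n k) (sumsTo-cong (λ j → sym (X-cong k (D^-invFact k) j))
         (sumsTo-X^ k sumsTo-invFact)))

-- Passage to real series.

partialSum-fromℚ : ∀ a n m → seq (partialSum (fromℚ ∘ a) n) m ≡ sum< n a
partialSum-fromℚ a zero    m = refl
partialSum-fromℚ a (suc n) m = cong (_+ a n) (partialSum-fromℚ a n m)

-- In `HasSum` the number of terms and the index of the representing sequences vary independently,
-- which is what the two indices in `close` provide for.
sumsTo⇒hasSum : ∀ {a q} → a SumsTo q ·e → HasSum (fromℚ ∘ a) (fromℚ q *ᴿ e)
sumsTo⇒hasSum {a} {q} ha ε 0<ε =
  let N , h = ha .close ε 0<ε
  in N , λ n n≥ ε′ 0<ε′ → N , λ m m≥ →
    subst (λ t → ∣ t - q * eSeq m ∣ ℚ.< ε + ε′) (sym (partialSum-fromℚ a n m))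
      (ℚₚ.<-trans (h n m n≥ m≥)
        (subst (ℚ._< ε + ε′) (ℚₚ.+-identityʳ ε) (ℚₚ.+-monoʳ-< ε 0<ε′)))

-- Rising factorials of the arguments as products of falling factorials.

-- The product over 1 ≤ l ≤ s is stored with a zero-based index, hence `suc l`: it absorbs the + 1
-- in the numerator k - l + 1.
d*arg+i : ∀ r s (s<r : s < r) k l i →
  ι (r ∸ s) * (arg r s s<r k (suc l) + ι i) ≡ ι (i · (r ∸ s) ∔ k) - ι l
d*arg+i r s s<r k l i = begin
  ι d * (z / d + ι i)             ≡⟨ ℚₚ.*-distribˡ-+ (ι d) (z / d) (ι i) ⟩
  ι d * (z / d) + ι d * ι i       ≡⟨ cong₂ _+_ (*-/-cancel d z) (ℚₚ.*-comm (ι d) (ι i)) ⟩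
  z / 1 + ι i * ι d               ≡⟨ cong₂ _+_ z/1 (sym (ι-homo-* i d)) ⟩
  (ι k - ι l) + ι (i · d)         ≡⟨ ℚₚ.+-comm (ι k - ι l) (ι (i · d)) ⟩
  ι (i · d) + (ι k - ι l)         ≡⟨ ℚₚ.+-assoc (ι (i · d)) (ι k) (- ι l) ⟨
  (ι (i · d) + ι k) - ι l         ≡⟨ cong (_- ι l) (ι-homo-+ (i · d) k) ⟨
  ι (i · d ∔ k) - ι l             ∎
  where
  open ≡-Reasoning
  d = r ∸ s
  z = (+ k) ℤ.- (+ suc l) ℤ.+ (+ 1)
  instance
    d≢0 : NonZero d
    d≢0 = >-nonZero (ℕₚ.m<n⇒0<n∸m s<r)
  z/1 : z / 1 ≡ ι k - ι l
  z/1 = trans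
    (cong (_/ 1) (ℤ-Solver.solve 2 (λ k l → k :- (con (+ 1) :+ l) :+ con (+ 1) := k :- l) refl (+ k) (+ l)))
    (/1-homo-sub (+ k) (+ l))
    where open ℤ-Solver using (_:+_; _:-_; _:=_; con)

-- The double product has sn factors. Each absorbs one r - s, which clears its denominator, and
-- exchanging the two products collects the falling factorials.
d^sn*rising : ∀ r s n (s<r : s < r) k →
  ι ((r ∸ s) ^ (s · n)) * (Π[ l ∈ 1 ⋯ s ] rising (arg r s s<r k l) n)
    ≡ prod< n (λ i → falling (ι (i · (r ∸ s) ∔ k)) s)
d^sn*rising r s n s<r k = begin
  ι (d ^ (s · n)) * prod< s (λ l → rising (α l) n)
    -- The exponent is reordered so that the power splits as (dⁿ)ˢ, one dⁿ for each rising
    -- factorial.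
    ≡⟨ cong (λ t → ι (d ^ t) * prod< s (λ l → rising (α l) n)) (ℕₚ.*-comm s n) ⟩
  ι (d ^ (n · s)) * prod< s (λ l → rising (α l) n)
    ≡⟨ cong (λ t → ι t * prod< s (λ l → rising (α l) n)) (ℕₚ.^-*-assoc d n s) ⟨
  ι ((d ^ n) ^ s) * prod< s (λ l → rising (α l) n)
    ≡⟨ prod<-ι^ s (d ^ n) (λ l → rising (α l) n) ⟩
  prod< s (λ l → ι (d ^ n) * rising (α l) n)
    ≡⟨ prod<-cong s (λ l → prod<-ι^ n d (λ i → α l + ι i)) ⟩
  prod< s (λ l → prod< n (λ i → ι d * (α l + ι i)))
    ≡⟨ prod<-cong s (λ l → prod<-cong n (d*arg+i r s s<r k l)) ⟩
  prod< s (λ l → prod< n (λ i → ι (i · d ∔ k) - ι l))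
    ≡⟨ prod<-swap s n (λ l i → ι (i · d ∔ k) - ι l) ⟩
  prod< n (λ i → falling (ι (i · d ∔ k)) s) ∎
  where
  open ≡-Reasoning
  d = r ∸ s
  α : ℕ → ℚ
  α l = arg r s s<r k (suc l)

theorem2 : (r s n : ℕ) (s<r : s < r) → 1 ≤ s → 1 ≤ n →
    (S : ℕ → ℕ → ℚ) → IsStirling r s S →
    ∃[ T ] (HasSum (λ k → fromℚ (invFact k * (Π[ l ∈ 1 ⋯ s ] rising (arg r s s<r k l) n))) T
    × fromℚ (bell s S n) ≃ᴿ (fromℕ ((r ∸ s) ^ (s · n)) /ᴿ e [ e#0 ]) *ᴿ T)
theorem2 r s n s<r 1≤s 1≤n S isS =
  -- The sum of the series is bell · e / (r-s)^(sn), with `v` the reciprocal of the power.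
  fromℚ (v * b) *ᴿ e , sumsTo⇒hasSum (sumsTo-cong summand (sumsTo-*ˡ v scaled)) , value
  where
  open ≡-Reasoning
  d = r ∸ s
  instance
    P≢0 : NonZero (d ^ (s · n))
    P≢0 = ℕₚ.m^n≢0 d (s · n) {{>-nonZero (ℕₚ.m<n⇒0<n∸m s<r)}}
  P v b : ℚ
  P = ι (d ^ (s · n))
  v = + 1 / (d ^ (s · n))
  b = bell s S n
  Q F : Series
  Q k = Π[ l ∈ 1 ⋯ s ] rising (arg r s s<r k l) n
  F k = prod< n (λ i → falling (ι (i · d ∔ k)) s)

  vP : v * P ≡ 1ℚ
  vP = trans (ℚₚ.*-comm v P) (ι*1/ (d ^ (s · n)))

  scaled : (λ j → F j * invFact j) SumsTo b ·e
  scaled = sumsTo-cong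
    -- Both sides of the normal ordering of eˣ are read at exponent n(r-s) + j: `X-coeff` strips the
    -- outer power of x on one side, `XrDs^n-coeff` evaluates the other.
    (λ j → trans (sym (X-coeff (n · d) _ j))
      (trans (sym (isS n 1≤n invFact (n · d ∔ j)))
        (XrDs^n-coeff s d (ℕₚ.m∸n+n≡m (ℕₚ.<⇒≤ s<r)) n invFact j)))
    (sumsTo-normalOrdered s S n)

  summand : ∀ k → v * (F k * invFact k) ≡ invFact k * Q k
  summand k = begin
    v * (F k * invFact k)       ≡⟨ cong (λ t → v * (t * invFact k)) (d^sn*rising r s n s<r k) ⟨
    v * (P * Q k * invFact k)   ≡⟨ cong (v *_) (ℚₚ.*-assoc P (Q k) (invFact k)) ⟩
    v * (P * (Q k * invFact k)) ≡⟨ ℚₚ.*-assoc v P (Q k * invFact k) ⟨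
    v * P * (Q k * invFact k)   ≡⟨ cong (_* (Q k * invFact k)) vP ⟩
    1ℚ * (Q k * invFact k)      ≡⟨ ℚₚ.*-identityˡ (Q k * invFact k) ⟩
    Q k * invFact k             ≡⟨ ℚₚ.*-comm (Q k) (invFact k) ⟩
    invFact k * Q k             ∎

  cancel : ∀ E .{{_ : ℚ.NonZero E}} → P * (ℚ.1/ E) * (v * b * E) ≡ b
  cancel E = begin
    P * (ℚ.1/ E) * (v * b * E)   ≡⟨ *-CS.interchange P (ℚ.1/ E) (v * b) E ⟩
    P * (v * b) * ((ℚ.1/ E) * E) ≡⟨ cong (P * (v * b) *_) (ℚₚ.*-inverseˡ E) ⟩
    P * (v * b) * 1ℚ             ≡⟨ ℚₚ.*-identityʳ (P * (v * b)) ⟩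
    P * (v * b)                  ≡⟨ *-CS.x∙yz≈yx∙z P v b ⟩
    v * P * b                    ≡⟨ cong (_* b) vP ⟩
    1ℚ * b                       ≡⟨ ℚₚ.*-identityˡ b ⟩
    b                            ∎

  value : fromℚ b ≃ᴿ (fromℕ (d ^ (s · n)) /ᴿ e [ e#0 ]) *ᴿ (fromℚ (v * b) *ᴿ e)
  -- `e#0` drops no initial terms, so the inverse of e has exactly 1/`eSeq m` at index m. The
  -- factors cancel at every index, and the threshold 0 works for all ε.
  value ε 0<ε = 0 , λ m _ → subst (ℚ._< ε)
    (sym (trans (cong (λ t → ∣ b - t ∣) (cancel (eSeq m) {{e≢0 m}})) (p-p b))) 0<ε
    where
    e≢0 : ∀ m → ℚ.NonZero (eSeq m)
    e≢0 m = let δ , _ , 0<δ , h = e#0 in ∣p∣>0⇒nonZero (eSeq m) 0<δ (h m z≤n)
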